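{- Let $\mathcal{A} \in \{\text{GS}, \text{DFS}, \text{LDFS}, \text{MCS}, \text{MNS}\}$ and let $v$ be a vertex of a finite, simple, undirected, connected graph $G$ with at least two vertices. The following are equivalent: (i) $v$ is the $\mathcal{L}$-root leaf of some $\mathcal{A}$-ordering of $G$; (ii) $v$ is an $\mathcal{L}$-leaf of some $\mathcal{A}$-ordering of $G$; (iii) $v$ is not a cut vertex of $G$.
   Context: A vertex ordering of $G$ is a bijection $\sigma:\{1,\dots,n\}\to V(G)$; $u \prec_\sigma w$ means $u$ comes before $w$. Searches are defined by the following label search: initially every vertex has label $\emptyset$; for $i=1,\dots,n$, choose any unnumbered vertex $x$ such that there is no unnumbered $y$ with $\mathrm{label}(x) \prec_{\mathcal{A}} \mathrm{label}(y)$, set $\sigma(i)=x$, and add $i$ to the labels of all unnumbered neighbors of $x$. The orderings produced are the $\mathcal{A}$-orderings. The strict partial orders on finite subsets of positive integers are: GS: $A \prec B$ iff $A=\emptyset$ and $B\neq\emptyset$. DFS: $A \prec B$ iff ($A=\emptyset$, $B\neq\emptyset$) or $\max(A)<\max(B)$. LDFS: $A \prec B$ iff $A\subsetneq B$ or $\max(A\setminus B)<\max(B\setminus A)$. MCS: $A\prec B$ iff $|A|<|B|$. MNS: $A \prec B$ iff $A \subsetneq B$. For a GS ordering $\sigma$ of connected $G$, the $\mathcal{L}$-tree of $\sigma$ is the spanning tree containing, for each vertex $v\neq\sigma(1)$, the edge from $v$ to its rightmost neighbor $w$ with $w\prec_\sigma v$. A vertex is an $\mathcal{L}$-leaf of $\sigma$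 if it is a leaf of the $\mathcal{L}$-tree; it is the $\mathcal{L}$-root leaf if additionally it equals $\sigma(1)$. -}

module Defs where

open import Data.Bool.Base using (if_then_else_; _∧_)
open import Data.Fin.Base as Fin using (Fin; toℕ; fromℕ<)
import Data.Fin.Properties as Fin
open import Data.Fin.Subset as Subset using (Subset; ⁅_⁆; _∪_; _─_; _⊂_; ∣_∣; Empty; Nonempty)
open import Data.Nat.Base as ℕ using (ℕ; zero; suc)
import Data.Nat.Properties as ℕ
open import Data.Product using (_×_; _,_; proj₁; ∃; ∃₂; ∃!)
open import Data.Refinement using (Refinement-syntax; value)
open import Data.Sum.Base using (_⊎_; inj₁; inj₂; swap)
open import Function.Base using (_on_)
open import Function.Bundles using (_↔_; Inverse)
open import Level using (0ℓ)
open import Relation.Binary.Core using (Rel)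
open import Relation.Binary.Construct.Closure.ReflexiveTransitive using (Star)
open import Relation.Binary.Definitions using (Decidable; Symmetric)
open import Relation.Binary.PropositionalEquality using (_≡_; _≢_; refl)
open import Relation.Nullary using (¬_; Dec; does)
open import Relation.Nullary.Decidable using (_×-dec_; _⊎-dec_; _→-dec_)

-- Finiteness is not part of the record: it is supplied separately, as an
-- enumeration Fin n ↔ V of the vertices.
record Graph (V : Set) : Set₁ where
  infix 4 _~_ _~?_
  field
    _~_    : Rel V 0ℓ
    _~?_   : Decidable _~_
    sym    : Symmetric _~_
    irrefl : ∀ {v} → ¬ (v ~ v)

Reachable : ∀ {V} → Graph V → Rel V 0ℓ
Reachable G = Star (Graph._~_ G)

Connected : ∀ {V} → Graph V → Set
Connected G = ∀ u w → Reachable G u w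

-- The induced subgraph on V \ {v}. The proof of x ≢ v in a vertex is
-- irrelevant, so vertices with the same value are equal.
infixl 6 _-_
_-_ : ∀ {V} → Graph V → (v : V) → Graph [ x ∈ V ∣ x ≢ v ]
G - v = record
  { _~_    = _~_ on value
  ; _~?_   = λ x y → value x ~? value y
  ; sym    = sym
  ; irrefl = irrefl
  }
  where open Graph G

-- Deleting v breaks up a connected component of G. For connected G this says
-- that G - v is disconnected.
CutVertex : ∀ {V} → Graph V → V → Set
CutVertex G v =
  ∃₂ λ u w → Reachable G (value u) (value w) × ¬ Reachable (G - v) u w

Leaf : ∀ {V} → Graph V → V → Set
Leaf T v = ∃! _≡_ λ w → Graph._~_ T v w

data Search : Set where
  GS DFS LDFS MCS MNS : Search

IsMax : ∀ {n} → Subset n → Fin n → Set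
IsMax A m = m Subset.∈ A × (∀ {i} → i Subset.∈ A → i Fin.≤ m)

-- max(A) < max(B), false if A or B has no maximum.
MaxLess : ∀ {n} → Rel (Subset n) 0ℓ
MaxLess A B = ∃₂ λ a b → IsMax A a × IsMax B b × a Fin.< b

-- Labels are subsets of Fin n, whose element i stands for the integer i + 1.
LabelOrder : Search → ∀ {n} → Rel (Subset n) 0ℓ
LabelOrder GS   A B = Empty A × Nonempty B
LabelOrder DFS  A B = (Empty A × Nonempty B) ⊎ MaxLess A B
LabelOrder LDFS A B = A ⊂ B ⊎ MaxLess (A ─ B) (B ─ A)
LabelOrder MCS  A B = ∣ A ∣ ℕ.< ∣ B ∣
LabelOrder MNS  A B = A ⊂ B

-- Positions are counted from 0, so σ(1) is the vertex at position 0.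
Ordering : ℕ → Set → Set
Ordering n V = Fin n ↔ V

module _ {n : ℕ} {V : Set} (σ : Ordering n V) where

  at : Fin n → V
  at = Inverse.to σ

  position : V → Fin n
  position = Inverse.from σ

  Before : Rel V 0ℓ
  Before u w = position u Fin.< position w

  First : V → Set
  First v = toℕ (position v) ≡ 0

module _ {n : ℕ} {V : Set} (G : Graph V) (σ : Ordering n V) where

  open Graph G

  -- The label of x after k rounds of the search that chooses at σ i in round i.
  -- A vertex chosen in round j is unnumbered after round i iff i < j.
  labelAfter : (k : ℕ) → .(k ℕ.≤ n) → V → Subset n
  labelAfter zero    _   x = Subset.⊥
  labelAfter (suc k) k<n x =
    if does (i Fin.<? position σ x) ∧ does (at σ i ~? x)
    then old ∪ ⁅ i ⁆
    else old
    where
    i : Fin n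
    i = fromℕ< k<n

    old : Subset n
    old = labelAfter k (ℕ.<⇒≤ k<n) x

  label : Fin n → V → Subset n
  label i = labelAfter (toℕ i) (Fin.toℕ≤n i)

  -- At the start of round i the unnumbered vertices are those at positions ≥ i;
  -- in particular at σ i is one of them.
  IsSearchOrdering : Search → Set
  IsSearchOrdering 𝒜 = ∀ i →
    ¬ (∃ λ y → i Fin.≤ position σ y × LabelOrder 𝒜 (label i (at σ i)) (label i y))

  -- w is the rightmost neighbour of v among those before v. The first vertex
  -- has no such w.
  Parent : Rel V 0ℓ
  Parent v w =
    Before σ w v × v ~ w ×
    (∀ j → j Fin.< position σ v → v ~ at σ j → j Fin.≤ position σ w)

  parent? : Decidable Parent
  parent? v w =
    (position σ w Fin.<? position σ v) ×-dec (v ~? w) ×-dec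
    Fin.all? (λ j → (j Fin.<? position σ v) →-dec
                    ((v ~? at σ j) →-dec (j Fin.≤? position σ w)))

  𝓛-tree : Graph V
  𝓛-tree = record
    { _~_    = λ u w → Parent u w ⊎ Parent w u
    ; _~?_   = λ u w → parent? u w ⊎-dec parent? w u
    ; sym    = swap
    ; irrefl = λ { (inj₁ p) → ℕ.<-irrefl refl (proj₁ p)
                 ; (inj₂ p) → ℕ.<-irrefl refl (proj₁ p) }
    }

  𝓛-Leaf : V → Set
  𝓛-Leaf = Leaf 𝓛-tree

  𝓛-RootLeaf : V → Set
  𝓛-RootLeaf v = 𝓛-Leaf v × First σ v

{-# OPTIONS --safe #-}
module Submission where

-- From parent to parent all other vertices reach a common one without passing an
-- 𝓛-leaf v: the root, or the only child of v if v is the root.  So G - v stays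
-- connected.  Conversely, choose in every round an unnumbered vertex
-- whose label has the largest rank, starting at v.  The rank increases along ≺,
-- so this is a search.  It also puts every label with an element other than the
-- position of v above {v} and ∅; as G - v is connected, from the third vertex
-- on the chosen one has an earlier neighbour other than v, so v has one child.

open import Defs
open import Data.Bool.Base using (if_then_else_; _∧_)
open import Data.Empty using (⊥; ⊥-elim-irr)
open import Data.Fin.Base as Fin using (Fin; zero; suc; toℕ; fromℕ<)
import Data.Fin.Permutation as Perm
import Data.Fin.Properties as Fin
open import Data.Fin.Subset as Subset
  using (Subset; Side; inside; outside; _∈_; _∉_; _⊆_; ⁅_⁆; _∪_; _─_; ∣_∣; Empty; Nonempty)
open import Data.Fin.Subset.Properties
  using (_∈?_; nonempty?; Empty-unique; ∉⊥; ∣⊥∣≡0; x∈⁅x⁆; x∈⁅y⁆⇒x≡y; x∈p∪q⁺; x∈p∪q⁻;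
         ⊆-antisym; p⊂q⇒∣p∣<∣q∣; x∈p∧x∉q⇒x∈p─q; p─q⊆p)
open import Data.Irrelevant using ([_])
open import Data.List.Base using (allFin; filter)
open import Data.List.Extrema.Nat using (argmax; argmax-all; f[xs]≤f[argmax])
open import Data.List.Membership.Propositional.Properties using (∈-allFin; ∈-filter⁺)
open import Data.List.Relation.Unary.All as All using ()
open import Data.List.Relation.Unary.All.Properties using (all-filter)
open import Data.Nat.Base as ℕ using (ℕ; zero; suc; _+_; _*_; _≤_; _<_; z≤n; s≤s)
open import Data.Nat.Induction using (<-wellFounded)
import Data.Nat.Properties as ℕ
open import Data.Product using (_×_; _,_; proj₁; proj₂; ∃; ∃₂)
open import Data.Refinement using (_,_; value)
open import Data.Sum.Base using (_⊎_; inj₁; inj₂)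
open import Data.Vec.Base using (_∷_; []; here; there)
open import Function.Base using (_∘_)
open import Function.Bundles using (_↔_; _⇔_; mk⇔; Inverse)
open import Function.Construct.Composition using (_↔-∘_)
open import Induction.WellFounded using (Acc; acc)
open import Level using (0ℓ)
open import Relation.Binary.Core using (Rel)
open import Relation.Binary.Construct.Closure.ReflexiveTransitive using (Star; ε; _◅_; _◅◅_; reverse)
open import Relation.Binary.PropositionalEquality
  using (_≡_; _≢_; refl; sym; trans; cong; subst; subst₂; module ≡-Reasoning)
open import Relation.Nullary using (¬_; Dec; yes; no; does; contradiction)
open import Relation.Nullary.Decidable using (_×-dec_)
open import Relation.Unary using (Pred; Decidable)

-- Finite maxima and edges leaving a set

maximiser : ∀ {n} {P : Pred (Fin n) 0ℓ} (f : Fin n → ℕ) → Decidable P → ∃ P →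
            ∃ λ m → P m × (∀ {j} → P j → f j ≤ f m)
maximiser {n} f P? (i , pi) =
  argmax f i candidates ,
  argmax-all f pi (all-filter P? (allFin n)) ,
  λ {j} pj → All.lookup (f[xs]≤f[argmax] i candidates) (∈-filter⁺ P? (∈-allFin j) pj)
  where candidates = filter P? (allFin n)

-- Connectivity enters through this: with `P` the vertices before a given position, the step found
-- is an edge from a numbered to an unnumbered vertex.
crossing : ∀ {A : Set} {R : Rel A 0ℓ} {P : Pred A 0ℓ} → Decidable P →
           ∀ {a b} → Star R a b → P a → ¬ P b → ∃₂ λ c d → P c × ¬ P d × R c d
crossing P? ε pa ¬pb = contradiction pa ¬pb
crossing P? {a} (_◅_ {j = c} r rs) pa ¬pb with P? c
... | yes pc = crossing P? rs pc ¬pb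
... | no ¬pc = a , c , pa , ¬pc , r

x∈p─q⇒x∉q : ∀ {n} (p q : Subset n) {x} → x ∈ p ─ q → x ∉ q
x∈p─q⇒x∉q (inside  ∷ p) (outside ∷ q) here ()
x∈p─q⇒x∉q (_ ∷ p) (inside  ∷ q) (there x∈) (there x∈q) = x∈p─q⇒x∉q p q x∈ x∈q
x∈p─q⇒x∉q (_ ∷ p) (outside ∷ q) (there x∈) (there x∈q) = x∈p─q⇒x∉q p q x∈ x∈q

-- Ranks of labels

bit : Side → ℕ
bit outside = 0
bit inside  = 1

-- Element `i` contributes 2^i, so values compare colexicographically: the largest element of the
-- symmetric difference decides.
binary : ∀ {n} → Subset n → ℕ
binary []      = 0
binary (s ∷ A) = bit s + 2 * binary A

weight : Search → ∀ {n} → Subset n → ℕ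
weight MCS A = ∣ A ∣
weight _   A = binary A

-- Element 0 is the position of the start vertex, which gets the least weight.
rank : Search → ∀ {n} → Subset (suc n) → ℕ
rank 𝒜 (s ∷ A) = bit s + 2 * weight 𝒜 A

bit≤1 : ∀ s → bit s ≤ 1
bit≤1 outside = z≤n
bit≤1 inside  = s≤s z≤n

bit+2*-mono-< : ∀ s t {x y} → x < y → bit s + 2 * x < bit t + 2 * y
bit+2*-mono-< s t {x} {y} x<y = begin-strict
  bit s + 2 * x ≤⟨ ℕ.+-monoˡ-≤ (2 * x) (bit≤1 s) ⟩
  1 + 2 * x     <⟨ ℕ.n<1+n _ ⟩
  2 + 2 * x     ≡⟨ ℕ.*-suc 2 x ⟨
  2 * suc x     ≤⟨ ℕ.*-monoʳ-≤ 2 x<y ⟩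
  2 * y         ≤⟨ ℕ.m≤n+m (2 * y) (bit t) ⟩
  bit t + 2 * y ∎
  where open ℕ.≤-Reasoning

binary-mono-≤ : ∀ {n} {A B : Subset n} → A ⊆ B → binary A ≤ binary B
binary-mono-≤ {A = []} {[]} _ = z≤n
binary-mono-≤ {A = s ∷ A} {t ∷ B} A⊆B =
  ℕ.+-mono-≤ (bit-mono s t A⊆B) (ℕ.*-monoʳ-≤ 2 (binary-mono-≤ (drop A⊆B)))
  where
  bit-mono : ∀ {n} {A B : Subset n} s t → s ∷ A ⊆ t ∷ B → bit s ≤ bit t
  bit-mono outside t       _   = z≤n
  bit-mono inside  inside  _   = ℕ.≤-refl
  bit-mono inside  outside s⊆t with () ← s⊆t here

  drop : ∀ {n s t} {A B : Subset n} → s ∷ A ⊆ t ∷ B → A ⊆ B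
  drop s⊆t x∈A with there x∈B ← s⊆t (there x∈A) = x∈B

-- Above `b` inclusion is required instead of agreement, so `b` need not be the largest difference
-- and any witness of `⊂` will do.
DiffersAt : ∀ {n} → Subset n → Subset n → Fin n → Set
DiffersAt A B b = b ∈ B × b ∉ A × (∀ {i} → b Fin.< i → i ∈ A → i ∈ B)

-- Digits below `b` cannot outweigh the gain at `b`, and above `b` the inclusion gives `≤`. The
-- recursion strips low digits until `b` is the lowest.
binary-mono-< : ∀ {n} {A B : Subset n} b → DiffersAt A B b → binary A < binary B
binary-mono-< {A = inside  ∷ A} {_ ∷ B} zero (_ , b∉A , _) = contradiction here b∉A
binary-mono-< {A = outside ∷ A} {inside ∷ B} zero (here , _ , above) =
  s≤s (ℕ.*-monoʳ-≤ 2 (binary-mono-≤ λ i∈A → drop (above (s≤s z≤n) (there i∈A))))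
  where
  drop : ∀ {i} → suc i ∈ inside ∷ B → i ∈ B
  drop (there i∈B) = i∈B
binary-mono-< {A = s ∷ A} {t ∷ B} (suc b) (there b∈B , b∉A , above) =
  bit+2*-mono-< s t (binary-mono-< b (b∈B , b∉A ∘ there , above′))
  where
  above′ : ∀ {i} → b Fin.< i → i ∈ A → i ∈ B
  above′ b<i i∈A with there i∈B ← above (s≤s b<i) (there i∈A) = i∈B

-- All five orders extend that of `GS`, so an argument that rests on this alone serves every search
-- at once.
Empty×Nonempty⇒LabelOrder : ∀ 𝒜 {n} {A B : Subset n} → Empty A → Nonempty B → LabelOrder 𝒜 A B
Empty×Nonempty⇒LabelOrder 𝒜 {A = A} {B} ∅A (b , b∈B) = order 𝒜
  where
  A⊂B : A Subset.⊂ B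
  A⊂B = (λ i∈A → contradiction (_ , i∈A) ∅A) , b , b∈B , λ b∈A → ∅A (b , b∈A)

  order : ∀ 𝒜 → LabelOrder 𝒜 A B
  order GS   = ∅A , b , b∈B
  order DFS  = inj₁ (∅A , b , b∈B)
  order LDFS = inj₁ A⊂B
  order MCS  = p⊂q⇒∣p∣<∣q∣ A⊂B
  order MNS  = A⊂B

⊂⇒DiffersAt : ∀ {n} {A B : Subset n} → A Subset.⊂ B → ∃ (DiffersAt A B)
⊂⇒DiffersAt (A⊆B , b , b∈B , b∉A) = b , b∈B , b∉A , λ _ → A⊆B

-- With `b` the maximum of `B`, no element of `A` reaches `b`, and the inclusion above `b` is
-- vacuous.
MaxLess⇒DiffersAt : ∀ {n} {A B : Subset n} → MaxLess A B → ∃ (DiffersAt A B)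
MaxLess⇒DiffersAt (a , b , (_ , A≤a) , (b∈B , _) , a<b) =
  b , b∈B , (λ b∈A → ℕ.<⇒≱ a<b (A≤a b∈A)) ,
  λ b<i i∈A → contradiction (A≤a i∈A) (ℕ.<⇒≱ (ℕ.<-trans a<b b<i))

MaxLess-─⇒DiffersAt : ∀ {n} (A B : Subset n) → MaxLess (A ─ B) (B ─ A) → ∃ (DiffersAt A B)
MaxLess-─⇒DiffersAt A B (a , b , (_ , ≤a) , (b∈ , _) , a<b) =
  b , p─q⊆p B A b∈ , x∈p─q⇒x∉q B A b∈ , above
  where
  above : ∀ {i} → b Fin.< i → i ∈ A → i ∈ B
  above {i} b<i i∈A with i ∈? B
  ... | yes i∈B = i∈B
  -- Such an `i` would lie in `A ─ B`, whose maximum `a` is below `b`.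
  ... | no  i∉B = contradiction (≤a (x∈p∧x∉q⇒x∈p─q i∈A i∉B)) (ℕ.<⇒≱ (ℕ.<-trans a<b b<i))

-- `MCS` is the exception: {2} precedes {0,1} by size, but its binary value is 4 against 3.
LabelOrder⇒DiffersAt : ∀ 𝒜 → 𝒜 ≢ MCS → ∀ {n} {A B : Subset n} → LabelOrder 𝒜 A B → ∃ (DiffersAt A B)
-- `MNS` is passed because its order is `⊂` itself.
LabelOrder⇒DiffersAt GS   _ (∅A , B≢∅) = ⊂⇒DiffersAt (Empty×Nonempty⇒LabelOrder MNS ∅A B≢∅)
LabelOrder⇒DiffersAt DFS  _ (inj₁ (∅A , B≢∅)) = ⊂⇒DiffersAt (Empty×Nonempty⇒LabelOrder MNS ∅A B≢∅)
LabelOrder⇒DiffersAt DFS  _ (inj₂ A<B) = MaxLess⇒DiffersAt A<B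
LabelOrder⇒DiffersAt LDFS _ (inj₁ A⊂B) = ⊂⇒DiffersAt A⊂B
LabelOrder⇒DiffersAt LDFS _ (inj₂ A<B) = MaxLess-─⇒DiffersAt _ _ A<B
LabelOrder⇒DiffersAt MCS  𝒜≢MCS _ = contradiction refl 𝒜≢MCS
LabelOrder⇒DiffersAt MNS  _ A⊂B = ⊂⇒DiffersAt A⊂B

rank-mono : ∀ 𝒜 {n} {A B : Subset (suc n)} → LabelOrder 𝒜 A B → rank 𝒜 A < rank 𝒜 B
rank-mono 𝒜 {A = s ∷ A} {t ∷ B} A≺B = helper 𝒜 A≺B
  where
  binary< : ∀ 𝒜 → 𝒜 ≢ MCS → LabelOrder 𝒜 (s ∷ A) (t ∷ B) → binary (s ∷ A) < binary (t ∷ B)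
  binary< 𝒜 𝒜≢MCS A≺B =
    let b , differs = LabelOrder⇒DiffersAt 𝒜 𝒜≢MCS A≺B in binary-mono-< b differs

  -- `bit s + 2 * ∣ A ∣` is twice the size of `s ∷ A` minus `bit s`. A gain of one in size becomes a
  -- gain of two, which a correction of at most one cannot cancel.
  size< : ∀ s t → ∣ s ∷ A ∣ < ∣ t ∷ B ∣ → bit s + 2 * ∣ A ∣ < bit t + 2 * ∣ B ∣
  size< outside outside A<B       = bit+2*-mono-< outside outside A<B
  size< outside inside  (s≤s A≤B) = s≤s (ℕ.*-monoʳ-≤ 2 A≤B)
  size< inside  outside A+1<B     = bit+2*-mono-< inside outside (ℕ.<⇒≤ A+1<B)
  size< inside  inside  (s≤s A<B) = bit+2*-mono-< inside inside A<B

  helper : ∀ 𝒜 → LabelOrder 𝒜 (s ∷ A) (t ∷ B) → rank 𝒜 (s ∷ A) < rank 𝒜 (t ∷ B)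
  helper GS   = binary< GS λ ()
  helper DFS  = binary< DFS λ ()
  helper LDFS = binary< LDFS λ ()
  helper MCS  = size< s t
  helper MNS  = binary< MNS λ ()

⊥-minimal : ∀ {n} {A : Subset n} → Nonempty A → Subset.⊥ Subset.⊂ A
⊥-minimal = Empty×Nonempty⇒LabelOrder MNS (∉⊥ ∘ proj₂)

weight-Nonempty : ∀ 𝒜 {n} {A : Subset n} → Nonempty A → 0 < weight 𝒜 A
weight-Nonempty 𝒜 {A = A} A≢∅ = helper 𝒜
  where
  binary> : 0 < binary A
  binary> = let b , differs = ⊂⇒DiffersAt (⊥-minimal A≢∅) in ℕ.≤-<-trans z≤n (binary-mono-< b differs)

  helper : ∀ 𝒜 → 0 < weight 𝒜 A
  helper GS   = binary>
  helper DFS  = binary>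
  helper LDFS = binary>
  helper MCS  = ℕ.≤-<-trans z≤n (p⊂q⇒∣p∣<∣q∣ (⊥-minimal A≢∅))
  helper MNS  = binary>

binary-⊥ : ∀ n → binary (Subset.⊥ {n}) ≡ 0
binary-⊥ zero    = refl
binary-⊥ (suc n) = cong (2 *_) (binary-⊥ n)

weight-⊥ : ∀ 𝒜 n → weight 𝒜 (Subset.⊥ {n}) ≡ 0
weight-⊥ GS   = binary-⊥
weight-⊥ DFS  = binary-⊥
weight-⊥ LDFS = binary-⊥
weight-⊥ MCS  = ∣⊥∣≡0
weight-⊥ MNS  = binary-⊥

-- The labels ∅ and {0} have ranks 0 and 1, so the threshold 2 detects an element other than the
-- start position. As a lower bound on rank, it passes from any candidate to the greedy choice.
suc∈⇒2≤rank : ∀ 𝒜 {n} {A : Subset (suc n)} {j} → suc j ∈ A → 2 ≤ rank 𝒜 A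
suc∈⇒2≤rank 𝒜 {A = s ∷ A} (there j∈A) =
  ℕ.≤-trans (ℕ.*-monoʳ-≤ 2 (weight-Nonempty 𝒜 (_ , j∈A))) (ℕ.m≤n+m _ (bit s))

2≤rank⇒suc∈ : ∀ 𝒜 {n} {A : Subset (suc n)} → 2 ≤ rank 𝒜 A → ∃ λ j → suc j ∈ A
2≤rank⇒suc∈ 𝒜 {n} {s ∷ A} 2≤ with nonempty? A
... | yes (j , j∈A) = j , there j∈A
... | no ∅A = contradiction (bit≤1 s) (ℕ.<⇒≱ (subst (2 ≤_) rank≡ 2≤))
  where
  open ≡-Reasoning
  rank≡ : bit s + 2 * weight 𝒜 A ≡ bit s
  rank≡ = begin
    bit s + 2 * weight 𝒜 A        ≡⟨ cong (λ A → bit s + 2 * weight 𝒜 A) (Empty-unique ∅A) ⟩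
    bit s + 2 * weight 𝒜 Subset.⊥ ≡⟨ cong (λ w → bit s + 2 * w) (weight-⊥ 𝒜 n) ⟩
    bit s + 0                     ≡⟨ ℕ.+-identityʳ (bit s) ⟩
    bit s                         ∎

-- Labels

module _ {n} {P Q : Set} {A : Subset n} {i j : Fin n} where

  -- One round of `labelAfter`, with its two tests generalised to arbitrary decisions so that
  -- matching on them reduces the conditional.
  ∈-if⁻ : (p? : Dec P) (q? : Dec Q) → j ∈ (if does p? ∧ does q? then A ∪ ⁅ i ⁆ else A) →
          j ∈ A ⊎ (j ≡ i × P × Q)
  ∈-if⁻ (no _)  _       j∈ = inj₁ j∈
  ∈-if⁻ (yes _) (no _)  j∈ = inj₁ j∈
  ∈-if⁻ (yes p) (yes q) j∈ with x∈p∪q⁻ A ⁅ i ⁆ j∈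
  ... | inj₁ j∈A = inj₁ j∈A
  ... | inj₂ j∈i = inj₂ (x∈⁅y⁆⇒x≡y i j∈i , p , q)

  ∈-if⁺ : (p? : Dec P) (q? : Dec Q) → j ∈ A ⊎ (j ≡ i × P × Q) →
          j ∈ (if does p? ∧ does q? then A ∪ ⁅ i ⁆ else A)
  ∈-if⁺ (yes _) (yes _) (inj₁ j∈A) = x∈p∪q⁺ (inj₁ j∈A)
  ∈-if⁺ (yes _) (yes _) (inj₂ (refl , _)) = x∈p∪q⁺ (inj₂ (x∈⁅x⁆ _))
  ∈-if⁺ (no _)  _       (inj₁ j∈A) = j∈A
  ∈-if⁺ (yes _) (no _)  (inj₁ j∈A) = j∈A
  ∈-if⁺ (no ¬p) _       (inj₂ (_ , p , _)) = contradiction p ¬p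
  ∈-if⁺ (yes _) (no ¬q) (inj₂ (_ , _ , q)) = contradiction q ¬q

module _ {n : ℕ} {V : Set} (σ : Ordering n V) where

  at-position : ∀ x → at σ (position σ x) ≡ x
  at-position = Inverse.strictlyInverseˡ σ

  position-at : ∀ i → position σ (at σ i) ≡ i
  position-at = Inverse.strictlyInverseʳ σ

  position-unique : ∀ {x i} → position σ x ≡ i → x ≡ at σ i
  position-unique {x} refl = sym (at-position x)

module _ {n : ℕ} {V : Set} (G : Graph V) (σ : Ordering n V) where

  open Graph G using (_~_; _~?_)

  ∈-labelAfter⁻ : ∀ k .(k≤n : k ≤ n) {x j} → j ∈ labelAfter G σ k k≤n x →
                  toℕ j < k × j Fin.< position σ x × at σ j ~ x
  ∈-labelAfter⁻ zero    _   j∈ = contradiction j∈ ∉⊥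
  ∈-labelAfter⁻ (suc k) k<n {x} j∈
    with ∈-if⁻ (fromℕ< k<n Fin.<? position σ x) (at σ (fromℕ< k<n) ~? x) j∈
  ... | inj₁ j∈old = let j<k , rest = ∈-labelAfter⁻ k (ℕ.<⇒≤ k<n) j∈old in ℕ.m<n⇒m<1+n j<k , rest
  ... | inj₂ (refl , rest) = s≤s (ℕ.≤-reflexive (Fin.toℕ-fromℕ< k<n)) , rest

  ∈-labelAfter⁺ : ∀ k .(k≤n : k ≤ n) {x j} → toℕ j < k → j Fin.< position σ x → at σ j ~ x →
                  j ∈ labelAfter G σ k k≤n x
  ∈-labelAfter⁺ (suc k) k<n {x} {j} (s≤s j≤k) j<x j~x =
    ∈-if⁺ (fromℕ< k<n Fin.<? position σ x) (at σ (fromℕ< k<n) ~? x) (split (ℕ.m≤n⇒m<n∨m≡n j≤k))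
    where
    split : toℕ j < k ⊎ toℕ j ≡ k → _
    split (inj₁ j<k)  = inj₁ (∈-labelAfter⁺ k (ℕ.<⇒≤ k<n) j<k j<x j~x)
    split (inj₂ refl) = inj₂ (sym i≡j , subst (λ i → i Fin.< position σ x × at σ i ~ x) (sym i≡j) (j<x , j~x))
      where
      i≡j : fromℕ< k<n ≡ j
      i≡j = Fin.fromℕ<-toℕ j k<n

  ∈-label⁻ : ∀ {i x j} → j ∈ label G σ i x → j Fin.< i × j Fin.< position σ x × at σ j ~ x
  ∈-label⁻ {i} = ∈-labelAfter⁻ (toℕ i) (Fin.toℕ≤n i)

  ∈-label⁺ : ∀ {i x j} → j Fin.< i → j Fin.< position σ x → at σ j ~ x → j ∈ label G σ i x
  ∈-label⁺ {i} = ∈-labelAfter⁺ (toℕ i) (Fin.toℕ≤n i)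

  -- Turns an edge found by `crossing` into an element of a label.
  earlier-neighbour∈label : ∀ {i y z} → position σ y Fin.< i → i Fin.≤ position σ z → y ~ z →
                            position σ y ∈ label G σ i z
  earlier-neighbour∈label {y = y} {z} y<i i≤z y~z =
    ∈-label⁺ y<i (ℕ.<-≤-trans y<i i≤z) (subst (_~ z) (sym (at-position σ y)) y~z)

-- Leaves are not cut vertices

module _ {n : ℕ} {V : Set} (G : Graph V) (σ : Ordering n V) (v : V) where

  -- Parents lie strictly earlier, so following them is a well-founded recursion on positions that
  -- can stop only at `b`.
  climb : ∀ {b} .(b≢v : b ≢ v) → (∀ x → x ≢ v → x ≢ b → ∃ λ y → y ≢ v × Parent G σ x y) →
          ∀ x .(x≢v : x ≢ v) → Reachable (G - v) (x , [ x≢v ]) (b , [ b≢v ])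
  climb {b} b≢v up x = go x (<-wellFounded _)
    where
    go : ∀ x → Acc _<_ (toℕ (position σ x)) → .(x≢v : x ≢ v) →
         Reachable (G - v) (x , [ x≢v ]) (b , [ b≢v ])
    -- Vertices are compared through their positions, since equality on `V` is not given as
    -- decidable.
    go x (acc rec) x≢v with position σ x Fin.≟ position σ b
    ... | yes px≡pb with refl ← trans (position-unique σ px≡pb) (at-position σ b) = ε
    ... | no  px≢pb =
      let y , y≢v , y<x , x~y , _ = up x (λ eq → ⊥-elim-irr (x≢v eq)) (λ { refl → px≢pb refl })
      in x~y ◅ go y (rec y<x) y≢v

  climb⇒¬CutVertex : ∀ {b} → b ≢ v → (∀ x → x ≢ v → x ≢ b → ∃ λ y → y ≢ v × Parent G σ x y) →
                     ¬ CutVertex G v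
  climb⇒¬CutVertex b≢v up ((x , [ x≢v ]) , (y , [ y≢v ]) , _ , ¬x⇝y) =
    ¬x⇝y (climb b≢v up x x≢v ◅◅ reverse (Graph.sym G) (climb b≢v up y y≢v))

module _ {n : ℕ} {V : Set} (G : Graph V) (σ : Ordering (suc n) V) where

  open Graph G using (_~_; _~?_) renaming (sym to ~-sym)

  root : V
  root = at σ zero

  ≢root⇒0<position : ∀ {x} → x ≢ root → zero {n} Fin.< position σ x
  ≢root⇒0<position {x} x≢r with position σ x in eq
  ... | zero  = contradiction (position-unique σ eq) x≢r
  ... | suc _ = s≤s z≤n

  module _ {𝒜 : Search} (connected : Connected G) (search : IsSearchOrdering G σ 𝒜) where

    -- If no neighbour preceded `x`, a path from the root to `x` would still cross to some `z` not
    -- before `x`. The label of `z` is nonempty, so every search prefers `z` to `x`.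
    earlier-neighbour : ∀ {x} → x ≢ root → Nonempty (label G σ (position σ x) x)
    earlier-neighbour {x} x≢r with nonempty? (label G σ (position σ x) x)
    ... | yes nonempty = nonempty
    ... | no ∅x  =
      let _ , z , y<x , z≮x , y~z = crossing (λ y → position σ y Fin.<? position σ x)
            (connected root x)
            (subst (Fin._< position σ x) (sym (position-at σ zero)) (≢root⇒0<position x≢r))
            (ℕ.<-irrefl refl)
          x≤z = ℕ.≮⇒≥ z≮x
      in contradiction
        (z , x≤z , Empty×Nonempty⇒LabelOrder 𝒜
          (subst (λ y → Empty (label G σ (position σ x) y)) (sym (at-position σ x)) ∅x)
          (_ , earlier-neighbour∈label G σ y<x x≤z y~z))
        (search (position σ x))

    parent : ∀ {x} → x ≢ root → ∃ (Parent G σ x)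
    parent {x} x≢r =
      let j , j∈ = earlier-neighbour x≢r
          _ , j<x , j~x = ∈-label⁻ G σ {i = position σ x} j∈
          m , (m<x , x~m) , max = maximiser toℕ
            (λ j → (j Fin.<? position σ x) ×-dec (x ~? at σ j)) (j , j<x , ~-sym j~x)
      in at σ m , subst (λ p → p Fin.< position σ x × x ~ at σ m ×
                                (∀ j → j Fin.< position σ x → x ~ at σ j → j Fin.≤ p))
                    (sym (position-at σ m)) (m<x , x~m , λ j j<x x~j → max (j<x , x~j))

    leaf⇒¬CutVertex : ∀ {v} → 𝓛-Leaf G σ v → ¬ CutVertex G v
    leaf⇒¬CutVertex {v} (w , v–w , unique) with position σ v Fin.≟ position σ root
    -- `v` is the root: each of its children equals `w`, so every other vertex has a parent
    -- different from `v` and the climb ends at `w`.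
    ... | yes v≡r with refl ← trans (position-unique σ v≡r) (at-position σ root) =
      climb⇒¬CutVertex G σ v (λ { refl → Graph.irrefl (𝓛-tree G σ) v–w }) λ x x≢r x≢w →
        let y , x→y = parent x≢r
        in y , (λ y≡r → x≢w (sym (unique (inj₂ (subst (Parent G σ x) y≡r x→y))))) , x→y
    ... | no v≢r =
      climb⇒¬CutVertex G σ v (λ { refl → v≢r refl }) λ x _ x≢r →
        let y , x→y = parent x≢r
            p , v→p = parent {v} (λ { refl → v≢r refl })
            -- The only tree neighbour of `v` is its parent, so a child of `v` would lie both before
            -- and after `v`.
            ¬x→v : ¬ Parent G σ x v
            ¬x→v = λ x→v → ℕ.<-asym (proj₁ x→v)
              (subst (λ u → Before σ u v) (trans (sym (unique (inj₁ v→p))) (unique (inj₂ x→v))) (proj₁ v→p))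
        in y , (λ y≡v → ¬x→v (subst (Parent G σ x) y≡v x→y)) , x→y

-- Greedy orderings

AgreeBelow : ∀ {n V} → Fin n → Ordering n V → Ordering n V → Set
AgreeBelow k σ τ = ∀ {j} → j Fin.< k → at τ j ≡ at σ j

AgreeBelow-sym : ∀ {n V} {k : Fin n} {σ τ : Ordering n V} → AgreeBelow k σ τ → AgreeBelow k τ σ
AgreeBelow-sym agree j<k = sym (agree j<k)

transpose-fixes : ∀ {n} {k p j : Fin n} → j ≢ k → j ≢ p → Perm.transpose k p Perm.⟨$⟩ʳ j ≡ j
transpose-fixes {k = k} {p} {j} j≢k j≢p with j Fin.≟ k
... | yes j≡k = contradiction j≡k j≢k
... | no _ with j Fin.≟ p
...   | yes j≡p = contradiction j≡p j≢p
...   | no _    = refl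

transpose-left : ∀ {n} (k p : Fin n) → Perm.transpose k p Perm.⟨$⟩ʳ k ≡ p
transpose-left k p with k Fin.≟ k
... | yes _  = refl
... | no k≢k = contradiction refl k≢k

-- Swapping positions `k` and `p` suffices: neither is below `k`, so the choices of earlier rounds
-- stay.
bring : ∀ {n V} (σ : Ordering n V) {k p : Fin n} → k Fin.≤ p →
        ∃ λ τ → at τ k ≡ at σ p × AgreeBelow k σ τ
bring σ {k} {p} k≤p =
  σ ↔-∘ Perm.transpose k p , cong (at σ) (transpose-left k p) ,
  λ j<k → cong (at σ) (transpose-fixes (Fin.<⇒≢ j<k) (Fin.<⇒≢ (ℕ.<-≤-trans j<k k≤p)))

module _ {n V} {σ τ : Ordering n V} {k : Fin n} (agree : AgreeBelow k σ τ) where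

  unnumbered-cong : ∀ {x} → k Fin.≤ position τ x → k Fin.≤ position σ x
  unnumbered-cong {x} k≤x = ℕ.≮⇒≥ λ x<k →
    let px≡ = trans (sym (position-at τ (position σ x)))
                    (cong (position τ) (trans (agree x<k) (at-position σ x)))
    in ℕ.<⇒≱ (subst (Fin._< k) px≡ x<k) k≤x

  label-⊆ : ∀ (G : Graph V) {x} → k Fin.≤ position τ x → label G σ k x ⊆ label G τ k x
  label-⊆ G {x} k≤x j∈ =
    let j<k , _ , j~x = ∈-label⁻ G σ {i = k} j∈
    in ∈-label⁺ G τ j<k (ℕ.<-≤-trans j<k k≤x) (subst (λ y → Graph._~_ G y x) (sym (agree j<k)) j~x)

module _ {n V} {σ τ : Ordering n V} {k : Fin n} (agree : AgreeBelow k σ τ) where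

  -- A label at the start of round `k` is determined by the choices of earlier rounds, so
  -- rearranging the unnumbered vertices does not change it.
  label-cong : ∀ (G : Graph V) {x} → k Fin.≤ position τ x → label G σ k x ≡ label G τ k x
  label-cong G k≤x = ⊆-antisym
    (label-⊆ {σ = σ} {τ} agree G k≤x)
    (label-⊆ {σ = τ} {σ} (AgreeBelow-sym {σ = σ} {τ} agree) G (unnumbered-cong {σ = σ} {τ} agree k≤x))

module _ {n : ℕ} {V : Set} (G : Graph V) (𝒜 : Search) where

  GreedyChoice : Ordering (suc n) V → Fin (suc n) → V → Set
  GreedyChoice σ i x = ∀ y → i Fin.≤ position σ y → rank 𝒜 (label G σ i y) ≤ rank 𝒜 (label G σ i x)

  -- Ensures that the swap made for a later round keeps the earlier rounds greedy.
  GreedyChoice-cong : ∀ {σ τ i x} → AgreeBelow i σ τ → i Fin.≤ position τ x →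
                      GreedyChoice σ i x → GreedyChoice τ i x
  GreedyChoice-cong {σ} {τ} agree i≤x greedy y i≤y =
    subst₂ _≤_ (cong (rank 𝒜) (label-cong {σ = σ} {τ} agree G i≤y))
               (cong (rank 𝒜) (label-cong {σ = σ} {τ} agree G i≤x))
               (greedy y (unnumbered-cong {σ = σ} {τ} agree i≤y))

  choose : ∀ σ k → ∃ λ p → k Fin.≤ p × GreedyChoice σ k (at σ p)
  choose σ k =
    let p , k≤p , max = maximiser (λ p → rank 𝒜 (label G σ k (at σ p))) (k Fin.≤?_) (k , ℕ.≤-refl)
    in p , k≤p , λ y k≤y →
         subst (λ y → rank 𝒜 (label G σ k y) ≤ rank 𝒜 (label G σ k (at σ p))) (at-position σ y) (max k≤y)

  at-self : ∀ (σ : Ordering (suc n) V) i → i Fin.≤ position σ (at σ i)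
  at-self σ i = ℕ.≤-reflexive (cong toℕ (sym (position-at σ i)))

  -- `σ` is a full bijection at every stage; the positions after `k` hold the unnumbered vertices in
  -- arbitrary order.
  GreedyUpTo : V → ℕ → Set
  GreedyUpTo v k = ∃ λ σ → at σ zero ≡ v × (∀ i → toℕ i ≤ k → GreedyChoice σ i (at σ i))

  start : Ordering (suc n) V → ∀ v → GreedyUpTo v 0
  start σ₀ v =
    let σ , σ0≡ , _ = bring σ₀ {zero} {position σ₀ v} z≤n
    -- In round 0 all labels are empty, so any start vertex is a greedy choice.
    in σ , trans σ0≡ (at-position σ₀ v) , λ { zero _ _ _ → ℕ.≤-refl }

  extend : ∀ {v k} → suc k < suc n → GreedyUpTo v k → GreedyUpTo v (suc k)
  extend {v} {k} 1+k<1+n (σ , σ0≡v , greedy) = go (choose σ i)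
    where
    i : Fin (suc n)
    i = fromℕ< 1+k<1+n

    i≡1+k : toℕ i ≡ suc k
    i≡1+k = Fin.toℕ-fromℕ< 1+k<1+n

    go : (∃ λ p → i Fin.≤ p × GreedyChoice σ i (at σ p)) → GreedyUpTo v (suc k)
    -- Position 0 is below `i`, so the swap leaves `v` in front.
    go (p , i≤p , best) = τ , trans (agree (subst (0 <_) (sym i≡1+k) (s≤s z≤n))) σ0≡v , up-to
      where
      τ : Ordering (suc n) V
      τ = proj₁ (bring σ i≤p)

      agree : AgreeBelow i σ τ
      agree = proj₂ (proj₂ (bring σ i≤p))

      keep : ∀ {j x} → j Fin.≤ i → at τ j ≡ x → GreedyChoice σ j x → GreedyChoice τ j (at τ j)
      keep {j} j≤i τj≡x best = GreedyChoice-cong {σ} {τ} (λ h<j → agree (ℕ.<-≤-trans h<j j≤i))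
        (at-self τ j) (subst (GreedyChoice σ j) (sym τj≡x) best)

      up-to : ∀ j → toℕ j ≤ suc k → GreedyChoice τ j (at τ j)
      up-to j j≤1+k with ℕ.m≤n⇒m<n∨m≡n j≤1+k
      ... | inj₁ (s≤s j≤k) = keep (ℕ.<⇒≤ j<i) (agree j<i) (greedy j j≤k)
        where
        j<i : j Fin.< i
        j<i = subst (toℕ j <_) (sym i≡1+k) (s≤s j≤k)
      ... | inj₂ j≡1+k =
        subst (λ j → GreedyChoice τ j (at τ j)) (Fin.toℕ-injective (trans i≡1+k (sym j≡1+k)))
              (keep ℕ.≤-refl (proj₁ (proj₂ (bring σ i≤p))) best)

  greedy-up-to : Ordering (suc n) V → ∀ v k → k < suc n → GreedyUpTo v k
  greedy-up-to σ₀ v zero    _       = start σ₀ v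
  greedy-up-to σ₀ v (suc k) 1+k<1+n = extend 1+k<1+n (greedy-up-to σ₀ v k (ℕ.<⇒≤ 1+k<1+n))

  greedy-ordering : Ordering (suc n) V → ∀ v →
                    ∃ λ σ → at σ zero ≡ v × (∀ i → GreedyChoice σ i (at σ i))
  greedy-ordering σ₀ v =
    -- The bound is inclusive: `n` is the last position in `Fin (suc n)`.
    let σ , σ0≡v , greedy = greedy-up-to σ₀ v n ℕ.≤-refl
    in σ , σ0≡v , λ i → greedy i (Fin.toℕ≤pred[n] i)

  greedy⇒search : ∀ {σ} → (∀ i → GreedyChoice σ i (at σ i)) → IsSearchOrdering G σ 𝒜
  greedy⇒search greedy i (y , i≤y , x≺y) = ℕ.<⇒≱ (rank-mono 𝒜 x≺y) (greedy i y i≤y)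

-- Non-cut vertices are root leaves

module _ {n : ℕ} {V : Set} (G : Graph V) (𝒜 : Search) (connected : Connected G)
         (σ : Ordering (suc (suc n)) V) (greedy : ∀ i → GreedyChoice G 𝒜 σ i (at σ i))
         (¬cut : ¬ CutVertex G (root G σ)) where

  open Graph G using (_~_)

  private
    second : V
    second = at σ (suc zero)

    search : IsSearchOrdering G σ 𝒜
    search = greedy⇒search G 𝒜 {σ} greedy

    at-injective : ∀ {i j} → at σ i ≡ at σ j → i ≡ j
    at-injective {i} {j} eq = trans (sym (position-at σ i)) (trans (cong (position σ) eq) (position-at σ j))

    second≢root : second ≢ root G σ
    second≢root eq with () ← at-injective eq

  -- A path from `second` to `x` avoiding the root crosses to some `z` not before `x` from a
  -- numbered vertex other than the root. The greedy choice `x` ranks no lower than `z`, so it too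
  -- has such a neighbour, which lies to the right of its supposed parent.
  late-child⊥ : ∀ {x} → 1 < toℕ (position σ x) → ¬ Parent G σ x (root G σ)
  late-child⊥ {x} 1<x (r<x , _ , rightmost) =
    -- `¬cut` yields the path only up to double negation, which is enough because the goal is `⊥`.
    ¬cut ((second , [ second≢root ]) , (x , [ x≢r ]) , connected second x , λ path →
      let (y , [ y≢r ]) , (z , _) , y<x , z≮x , y~z =
            crossing (λ y → position σ (value y) Fin.<? position σ x) path
              (subst (Fin._< position σ x) (sym (position-at σ (suc zero))) 1<x)
              (ℕ.<-irrefl refl)
          x≤z = ℕ.≮⇒≥ z≮x
      in helper y≢r (earlier-neighbour∈label G σ y<x x≤z y~z) x≤z)
    where
    x≢r : x ≢ root G σ
    x≢r refl = ℕ.<-irrefl refl r<x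

    helper : ∀ {y z} → .(y ≢ root G σ) → position σ y ∈ label G σ (position σ x) z →
             position σ x Fin.≤ position σ z → ⊥
    helper {y} {z} y≢r y∈ x≤z with position σ y in eq
    ... | zero  = ⊥-elim-irr (y≢r (position-unique σ eq))
    ... | suc _ =
      -- The position of `y` puts the rank of `z` at 2 or more, greediness carries the bound over to
      -- `x`, and so `x` has an earlier neighbour at a position `suc j`.
      let j , j∈ = 2≤rank⇒suc∈ 𝒜 (ℕ.≤-trans (suc∈⇒2≤rank 𝒜 y∈) (greedy (position σ x) z x≤z))
          j<x , _ , j~x = ∈-label⁻ G σ {i = position σ x} j∈
      in ℕ.<⇒≱ (s≤s z≤n) (subst (suc j Fin.≤_) (position-at σ zero)
           (rightmost (suc j) j<x (subst (_~ at σ (suc j)) (at-position σ x) (Graph.sym G j~x))))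

  before-second⇒root : ∀ {y} → Before σ y second → y ≡ root G σ
  before-second⇒root {y} y<s with position σ y in eq
  ... | zero  = position-unique σ eq
  ... | suc _ = contradiction (subst (_ <_) (cong toℕ (position-at σ (suc zero))) y<s) λ { (s≤s ()) }

  second→root : Parent G σ second (root G σ)
  second→root =
    let _ , s→y = parent G σ {𝒜} connected search second≢root
    in subst (Parent G σ second) (before-second⇒root (proj₁ s→y)) s→y

  root-leaf : 𝓛-RootLeaf G σ (root G σ)
  root-leaf = (second , inj₂ second→root , unique) , cong toℕ (position-at σ zero)
    where
    unique : ∀ {y} → Parent G σ (root G σ) y ⊎ Parent G σ y (root G σ) → second ≡ y
    unique {y} (inj₁ (y<r , _)) with () ← subst (λ p → position σ y Fin.< p) (position-at σ zero) y<r
    unique {y} (inj₂ y→r) with position σ y Fin.≟ suc zero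
    ... | yes y≡1 = sym (position-unique σ y≡1)
    ... | no  y≢1 = contradiction y→r (late-child⊥ (ℕ.≤∧≢⇒<
      (subst (Fin._< position σ y) (position-at σ zero) (proj₁ y→r))
      (λ 1≡y → y≢1 (Fin.toℕ-injective (sym 1≡y)))))

theorem2 : (𝒜 : Search) {n : ℕ} {V : Set} (G : Graph V) → Fin n ↔ V → 2 ≤ n → Connected G → (v : V) →
    ((∃ λ (σ : Ordering n V) → IsSearchOrdering G σ 𝒜 × 𝓛-RootLeaf G σ v)
    ⇔ (∃ λ (σ : Ordering n V) → IsSearchOrdering G σ 𝒜 × 𝓛-Leaf G σ v))
    × ((∃ λ (σ : Ordering n V) → IsSearchOrdering G σ 𝒜 × 𝓛-Leaf G σ v)
    ⇔ (¬ CutVertex G v))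
theorem2 𝒜 {n} {V} G σ₀ (s≤s (s≤s z≤n)) connected v =
  -- The implications form a cycle: (i) to (ii) by `forget`, (ii) to (iii) by `noncut`, (iii) to (i)
  -- by `rooted`.
  mk⇔ forget (rooted ∘ noncut) , mk⇔ noncut (forget ∘ rooted)
  where
  forget : (∃ λ (σ : Ordering n V) → IsSearchOrdering G σ 𝒜 × 𝓛-RootLeaf G σ v) →
           ∃ λ (σ : Ordering n V) → IsSearchOrdering G σ 𝒜 × 𝓛-Leaf G σ v
  forget (σ , search , leaf , _) = σ , search , leaf

  noncut : (∃ λ (σ : Ordering n V) → IsSearchOrdering G σ 𝒜 × 𝓛-Leaf G σ v) → ¬ CutVertex G v
  noncut (σ , search , leaf) = leaf⇒¬CutVertex G σ {𝒜} connected search leaf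

  rooted : ¬ CutVertex G v → ∃ λ (σ : Ordering n V) → IsSearchOrdering G σ 𝒜 × 𝓛-RootLeaf G σ v
  rooted ¬cut = go (greedy-ordering G 𝒜 σ₀ v) ¬cut
    where
    -- `v` is generalised so that `at σ zero ≡ v` can be matched with `refl`, making `v` the root of
    -- `σ`.
    go : ∀ {v} → (∃ λ σ → at σ zero ≡ v × (∀ i → GreedyChoice G 𝒜 σ i (at σ i))) → ¬ CutVertex G v →
         ∃ λ (σ : Ordering n V) → IsSearchOrdering G σ 𝒜 × 𝓛-RootLeaf G σ v
    go (σ , refl , greedy) ¬cut =
      σ , greedy⇒search G 𝒜 {σ} greedy , root-leaf G 𝒜 connected σ greedy ¬cut
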